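{- Let $\overline p$ be a finite set of propositional variables. For any non-deterministic modal automaton $\mathcal A$ over $\overline p$ with set of states $\overline q$ (the states being regarded as variables, distinct from those in $\overline p$), there exists an $\mathcal L$-term $\mathsf{acc}_{\mathcal A}(\overline p,\overline q)$ such that for any $\overline p$-coloured tree $(S,\sigma)$, we have $$\mathcal A\text{ accepts }(S_\omega,\sigma_\omega)\iff\mathbb P(S_\omega),V_{\sigma_\omega}\models\exists\overline q\;\mathsf{acc}_{\mathcal A}(\overline p,\overline q)=\top.$$
   Context: **Trees.** A transition system $(S,R)$ is a set with a binary relation, always assumed serial (every node has an $R$-successor). A root is a node $s_0$ from which every node is reachable by a path and such that the only path ending in $s_0$ is trivial. A tree is a transition system with a root $s_0$ such that each node is reached from $s_0$ by a unique path. A $\overline p$-colouring is $\sigma:S\to\mathcal P(\overline p)$, with associated valuation $V_\sigma(p):=\{s\mid p\in\sigma(s)\}$. **$\omega$-expansions.** The $\omega$-expansion of a tree $(S,R)$ with root $s_0$ is the tree $(S_\omega,R_\omega)$ whose nodes are the finite sequences $(k_1,s_1)\cdots(k_n,s_n)\in(\omega\times S)^*$ with $s_iRs_{i+1}$ for $0\le i<n$; the $R_\omega$-successors of $(k_1,s_1)\cdots(k_n,s_n)$ are its one-letter extensions by $(k_{n+1},s_{n+1})$ with $k_{n+1}\in\omega$, $s_nRs_{n+1}$. The root is the empty sequence $\epsilon$. For a colouring $\sigma$ of $S$, $\sigma_\omega(\epsilon):=\sigma(s_0)$ and $\sigma_\omega((k_1,s_1)\cdots(k_n,s_n)):=\sigma(s_n)$.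 **Complex algebras and $\mathcal L$.** $\mathcal L$ is the first-order language with function symbols $\bot,\vee,\neg,I,\Diamond,\mathrm{EU},\mathrm{EG}$ (arities $0,2,1,0,1,2,2$) and equality; $\top:=\neg\bot$. For a tree $S$ with root $s_0$, $\mathbb P(S)$ is the $\mathcal L$-structure on the power set Boolean algebra $\mathcal P(S)$ with $\Diamond a:=\{s\mid\exists t\in a,\ sRt\}$, $I:=\{s_0\}$, $\mathrm{EU}(a,b)$ the least $x$ with $a\vee(b\wedge\Diamond x)\le x$, and $\mathrm{EG}(a,b)$ the greatest $y$ with $y\le a\wedge\Diamond\mathrm{EU}(b\wedge y,a)$. On the right-hand side of the claim, the variables $\overline p$ are interpreted by $V_{\sigma_\omega}$, and $\exists\overline q$ ranges over elements of $\mathbb P(S_\omega)$. **Automata.** A non-deterministic modal automaton over $\overline p$ is $\mathcal A=(Q,q_0,\delta,\Omega)$ with $Q$ a finite set of states, $q_0\in Q$, $\delta:Q\times\mathcal P(\overline p)\to\mathcal P\mathcal P(Q)$, $\Omega:Q\to\omega$. It accepts $(S_\omega,\sigma_\omega)$ iff there is $r:S_\omega\to Q$ such that $r(\epsilon)=q_0$; for all $v\in S_\omega$, $\{r(v')\mid vR_\omega v'\}\in\delta(r(v),\sigma_\omega(v))$; and for every infinite path $(v_t)_{t\in\omega}$ in $S_\omega$ with $v_0=\epsilon$, $\min\{\Omega(q)\mid r(v_t)=q\text{ for infinitely many }t\}$ is even. -}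

module Defs where

open import Axiom.ExcludedMiddle using (ExcludedMiddle)
open import Data.Bool using (Bool; false; T; not; _∧_; _∨_)
open import Data.Bool.Properties using (T-∧; T-∨)
open import Data.Empty using (⊥; ⊥-elim)
open import Data.Fin using (Fin)
open import Data.Fin.Subset using (Subset; _∈_)
open import Data.Irrelevant using ([_])
open import Data.List using (List; []; _∷_; _++_; _∷ʳ_; map)
open import Data.List.Properties using
  (map-++; ++-assoc; ++-identityʳ; ++-identityʳ-unique; ++-cancelˡ; ++-conicalʳ; ∷-injectiveˡ)
open import Data.List.Relation.Unary.Linked using (Linked; []; [-]; _∷_)
open import Data.Nat using (ℕ; suc; _≤_)
open import Data.Nat.Divisibility using (_∣_)
open import Data.Product using (∃-syntax; _×_; _,_; proj₁; proj₂)
open import Data.Refinement using (Refinement-syntax; value; _,_)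
open import Data.Sum using (_⊎_; inj₁; inj₂)
open import Data.Vec using (lookup)
open import Function.Bundles using (_⇔_; module Equivalence)
open import Level using (Level; _⊔_) renaming (suc to lsuc)
open import Relation.Binary.Core using (Rel)
open import Relation.Binary.PropositionalEquality
  using (_≡_; refl; sym; trans; cong; subst; _≗_)
open import Relation.Nullary.Decidable using (⌊_⌋; toWitness; fromWitness)

------------------------------------------------------------------------
-- Trees

module _ {ℓ} {S : Set ℓ} where

  endpoint : S → List S → S
  endpoint s []      = s
  endpoint s (t ∷ w) = endpoint t w

  -- The path s, w₁, …, wₙ is given by its start s and the list w of its later
  -- nodes. Paths are sequences of nodes, so that comparing two paths does not
  -- involve comparing proofs of R.
  IsPath : Rel S ℓ → S → List S → S → Set ℓ
  IsPath R s w t = Linked R (s ∷ w) × endpoint s w ≡ t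

record Tree ℓ : Set (lsuc ℓ) where
  field
    Node         : Set ℓ
    _⟶_          : Rel Node ℓ
    serial       : ∀ s → ∃[ t ] s ⟶ t
    root         : Node
    reachable    : ∀ s → ∃[ w ] IsPath _⟶_ root w s
    root-initial : ∀ s w → IsPath _⟶_ s w root → w ≡ []
    unique-path  : ∀ s w w′ → IsPath _⟶_ root w s → IsPath _⟶_ root w′ s → w ≡ w′

-- The propositional variables p̄ are Fin k.
Colouring : ∀ {ℓ} → Tree ℓ → ℕ → Set ℓ
Colouring 𝒯 k = Tree.Node 𝒯 → Subset k

------------------------------------------------------------------------
-- ω-expansions

module Expansion {ℓ} (𝒯 : Tree ℓ) where
  open Tree 𝒯

  ωSeq : Set ℓ
  ωSeq = List (ℕ × Node)

  IsBranch : ωSeq → Set ℓ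
  IsBranch w = Linked _⟶_ (root ∷ map proj₂ w)

  -- Refinement makes the side condition proof-irrelevant, so that nodes are
  -- equal exactly when the underlying sequences are.
  Nodeω : Set ℓ
  Nodeω = [ w ∈ ωSeq ∣ IsBranch w ]

  lastNode : Nodeω → Node
  lastNode v = endpoint root (map proj₂ (value v))

  -- That the appended node is a successor of lastNode v is already part of
  -- v′ being an element of Nodeω.
  _⟶ω_ : Rel Nodeω ℓ
  v ⟶ω v′ = ∃[ a ] value v′ ≡ value v ∷ʳ a

  rootω : Nodeω
  rootω = [] , [ [-] ]

  private
    value-injective : ∀ {v v′ : Nodeω} → value v ≡ value v′ → v ≡ v′
    value-injective refl = refl

    linked-∷ʳ : ∀ s w {t} → Linked _⟶_ (s ∷ w) → endpoint s w ⟶ t →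
                Linked _⟶_ (s ∷ w ∷ʳ t)
    linked-∷ʳ s []      _       r = r ∷ [-]
    linked-∷ʳ s (_ ∷ w) (x ∷ l) r = x ∷ linked-∷ʳ _ w l r

    linked-++⁻ : ∀ s w u → Linked _⟶_ (s ∷ w ++ u) → Linked _⟶_ (s ∷ w)
    linked-++⁻ s []      u l       = [-]
    linked-++⁻ s (_ ∷ w) u (x ∷ l) = x ∷ linked-++⁻ _ w u l

    branch-∷ʳ : ∀ w k {t} → IsBranch w → endpoint root (map proj₂ w) ⟶ t →
                IsBranch (w ∷ʳ (k , t))
    branch-∷ʳ w k {t} l r =
      subst (λ z → Linked _⟶_ (root ∷ z)) (sym (map-++ proj₂ w ((k , t) ∷ [])))
        (linked-∷ʳ root (map proj₂ w) l r)

    branch-++⁻ : ∀ w u → IsBranch (w ++ u) → IsBranch w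
    branch-++⁻ w u l = linked-++⁻ root (map proj₂ w) (map proj₂ u)
      (subst (λ z → Linked _⟶_ (root ∷ z)) (map-++ proj₂ w u) l)

    serialω : ∀ v → ∃[ v′ ] v ⟶ω v′
    serialω v@(w , [ l ]) with serial (lastNode v)
    ... | t , r = (w ∷ʳ (0 , t) , [ branch-∷ʳ w 0 l r ]) , (0 , t) , refl

    pathTo : ∀ v u v′ → value v′ ≡ value v ++ u → ∃[ ws ] IsPath _⟶ω_ v ws v′
    pathTo v [] v′ eq =
      [] , [-] , value-injective (sym (trans eq (++-identityʳ (value v))))
    pathTo v (a ∷ u) (_ , [ l ]) refl
      with pathTo (value v ∷ʳ a , [ branch-++⁻ (value v ∷ʳ a) u
                     (subst IsBranch (sym (++-assoc (value v) (a ∷ []) u)) l) ])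
                  u (value v ++ a ∷ u , [ l ]) (sym (++-assoc (value v) (a ∷ []) u))
    ... | ws , path , end = _ ∷ ws , (a , refl) ∷ path , end

    extends : ∀ v ws v′ → IsPath _⟶ω_ v ws v′ → ∃[ u ] value v′ ≡ value v ++ u
    extends v []       v′ (_ , refl) = [] , sym (++-identityʳ (value v))
    extends v (x ∷ ws) v′ ((a , eq) ∷ l , end) with extends x ws v′ (l , end)
    ... | u , eq′ = a ∷ u ,
      trans eq′ (trans (cong (_++ u) eq) (++-assoc (value v) (a ∷ []) u))

    extends⁺ : ∀ v x ws v′ → IsPath _⟶ω_ v (x ∷ ws) v′ →
               ∃[ a ] ∃[ u ] value x ≡ value v ∷ʳ a × value v′ ≡ value v ++ a ∷ u
    extends⁺ v x ws v′ ((a , eq) ∷ l , end) with extends x ws v′ (l , end)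
    ... | u , eq′ = a , u , eq ,
      trans eq′ (trans (cong (_++ u) eq) (++-assoc (value v) (a ∷ []) u))

    noLoop : ∀ v x ws → IsPath _⟶ω_ v (x ∷ ws) v → ⊥
    noLoop v x ws p with extends⁺ v x ws v p
    ... | a , u , _ , eq with ++-identityʳ-unique (value v) eq
    ... | ()

    root-initialω : ∀ v ws → IsPath _⟶ω_ v ws rootω → ws ≡ []
    root-initialω v []       _ = refl
    root-initialω v (x ∷ ws) p with extends⁺ v x ws rootω p
    ... | a , u , _ , eq with ++-conicalʳ (value v) (a ∷ u) (sym eq)
    ... | ()

    uniqueω : ∀ v v′ ws ws′ → IsPath _⟶ω_ v ws v′ → IsPath _⟶ω_ v ws′ v′ → ws ≡ ws′
    uniqueω v v′ []       []         _ _ = refl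
    uniqueω v v′ []       (x ∷ ws′)  (_ , refl) p′ = ⊥-elim (noLoop v x ws′ p′)
    uniqueω v v′ (x ∷ ws) []         p (_ , refl) = ⊥-elim (noLoop v x ws p)
    uniqueω v v′ (x ∷ ws) (x′ ∷ ws′) p@(_ ∷ l , end) p′@(_ ∷ l′ , end′)
      with extends⁺ v x ws v′ p | extends⁺ v x′ ws′ v′ p′
    ... | a , u , eqx , eq | a′ , u′ , eqx′ , eq′
      with ∷-injectiveˡ (++-cancelˡ (value v) _ _ (trans (sym eq) eq′))
    ... | refl with value-injective {x} {x′} (trans eqx (sym eqx′))
    ... | refl = cong (x ∷_) (uniqueω x v′ ws ws′ (l , end) (l′ , end′))

  expansion : Tree ℓ
  expansion = record
    { Node         = Nodeω
    ; _⟶_          = _⟶ω_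
    ; serial       = serialω
    ; root         = rootω
    ; reachable    = λ v → pathTo rootω (value v) v refl
    ; root-initial = root-initialω
    ; unique-path  = uniqueω rootω
    }

  expandColouring : ∀ {k} → Colouring 𝒯 k → Colouring expansion k
  expandColouring σ v = σ (lastNode v)

open Expansion public using (expansion; expandColouring)

------------------------------------------------------------------------
-- The language ℒ

data Term (X : Set) : Set where
  var    : X → Term X
  ⊥ᵗ     : Term X
  _∨ᵗ_   : Term X → Term X → Term X
  ¬ᵗ_    : Term X → Term X
  Iᵗ     : Term X
  ◇ᵗ_    : Term X → Term X
  EUᵗ    : Term X → Term X → Term X
  EGᵗ    : Term X → Term X → Term X

⊤ᵗ : ∀ {X} → Term X
⊤ᵗ = ¬ᵗ ⊥ᵗ

record ℒ-Structure c e : Set (lsuc (c ⊔ e)) where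
  field
    Carrier : Set c
    _≈_     : Rel Carrier e
    ⊥ˢ      : Carrier
    _∨ˢ_    : Carrier → Carrier → Carrier
    ¬ˢ_     : Carrier → Carrier
    Iˢ      : Carrier
    ◇ˢ_     : Carrier → Carrier
    EUˢ     : Carrier → Carrier → Carrier
    EGˢ     : Carrier → Carrier → Carrier

  ⟦_⟧ : ∀ {X} → Term X → (X → Carrier) → Carrier
  ⟦ var x ⟧   V = V x
  ⟦ ⊥ᵗ ⟧      V = ⊥ˢ
  ⟦ t ∨ᵗ u ⟧  V = ⟦ t ⟧ V ∨ˢ ⟦ u ⟧ V
  ⟦ ¬ᵗ t ⟧    V = ¬ˢ ⟦ t ⟧ V
  ⟦ Iᵗ ⟧      V = Iˢ
  ⟦ ◇ᵗ t ⟧    V = ◇ˢ ⟦ t ⟧ V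
  ⟦ EUᵗ t u ⟧ V = EUˢ (⟦ t ⟧ V) (⟦ u ⟧ V)
  ⟦ EGᵗ t u ⟧ V = EGˢ (⟦ t ⟧ V) (⟦ u ⟧ V)

------------------------------------------------------------------------
-- Complex algebras

-- Subsets are represented by their characteristic functions. In the presence
-- of excluded middle every predicate has one, and arbitrary unions and
-- intersections of subsets stay at the same universe level.
𝒫 : ∀ {ℓ} → Set ℓ → Set ℓ
𝒫 S = S → Bool

module ComplexAlgebra {ℓ} (em : ExcludedMiddle ℓ) (𝒯 : Tree ℓ) where
  open Tree 𝒯

  ⟨_⟩ : (Node → Set ℓ) → 𝒫 Node
  ⟨ P ⟩ s = ⌊ em {P s} ⌋

  infix  4 _⊑_
  infixr 7 _∩_
  infixr 6 _∪_

  _⊑_ : Rel (𝒫 Node) ℓ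
  a ⊑ b = ∀ s → T (a s) → T (b s)

  ∅ : 𝒫 Node
  ∅ _ = false

  ∁ : 𝒫 Node → 𝒫 Node
  ∁ a s = not (a s)

  _∪_ _∩_ : 𝒫 Node → 𝒫 Node → 𝒫 Node
  (a ∪ b) s = a s ∨ b s
  (a ∩ b) s = a s ∧ b s

  I : 𝒫 Node
  I = ⟨ (λ s → s ≡ root) ⟩

  ◇ : 𝒫 Node → 𝒫 Node
  ◇ a = ⟨ (λ s → ∃[ t ] T (a t) × s ⟶ t) ⟩

  -- EU and EG are the intersection of all pre-fixed points and the union of all
  -- post-fixed points; EU-least, EU-isClosed, EG-greatest and EG-isClosed below
  -- show that they are themselves the least and greatest such subsets.
  EU-closed : 𝒫 Node → 𝒫 Node → 𝒫 Node → Set ℓ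
  EU-closed a b x = a ∪ (b ∩ ◇ x) ⊑ x

  EU : 𝒫 Node → 𝒫 Node → 𝒫 Node
  EU a b = ⟨ (λ s → ∀ x → EU-closed a b x → T (x s)) ⟩

  EG-closed : 𝒫 Node → 𝒫 Node → 𝒫 Node → Set ℓ
  EG-closed a b y = y ⊑ a ∩ ◇ (EU (b ∩ y) a)

  EG : 𝒫 Node → 𝒫 Node → 𝒫 Node
  EG a b = ⟨ (λ s → ∃[ y ] EG-closed a b y × T (y s)) ⟩

  private
    ∧⁻ : ∀ {x y} → T (x ∧ y) → T x × T y
    ∧⁻ = Equivalence.to T-∧

    ∧⁺ : ∀ {x y} → T x × T y → T (x ∧ y)
    ∧⁺ = Equivalence.from T-∧

    ◇-mono : ∀ {a b} → a ⊑ b → ◇ a ⊑ ◇ b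
    ◇-mono a⊑b s h with toWitness h
    ... | t , at , st = fromWitness (t , a⊑b t at , st)

    step-mono : ∀ {a a′ b x x′} → a ⊑ a′ → x ⊑ x′ → a ∪ (b ∩ ◇ x) ⊑ a′ ∪ (b ∩ ◇ x′)
    step-mono {a} {b = b} a⊑ x⊑ s h with Equivalence.to (T-∨ {a s}) h
    ... | inj₁ as = Equivalence.from T-∨ (inj₁ (a⊑ s as))
    ... | inj₂ r with ∧⁻ {b s} r
    ... | bs , ds = Equivalence.from T-∨ (inj₂ (∧⁺ (bs , ◇-mono x⊑ s ds)))

  EU-least : ∀ a b x → EU-closed a b x → EU a b ⊑ x
  EU-least a b x c s h = toWitness h x c

  EU-isClosed : ∀ a b → EU-closed a b (EU a b)
  EU-isClosed a b s h = fromWitness λ x c →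
    c s (step-mono {a} {b = b} (λ _ p → p) (EU-least a b x c) s h)

  EU-mono : ∀ {a a′} b → a ⊑ a′ → EU a b ⊑ EU a′ b
  EU-mono {a} {a′} b a⊑ = EU-least a b (EU a′ b) λ s h →
    EU-isClosed a′ b s (step-mono {a} {b = b} a⊑ (λ _ p → p) s h)

  EG-greatest : ∀ a b y → EG-closed a b y → y ⊑ EG a b
  EG-greatest a b y c s ys = fromWitness (y , c , ys)

  EG-isClosed : ∀ a b → EG-closed a b (EG a b)
  EG-isClosed a b s h with toWitness h
  ... | y , c , ys with ∧⁻ {a s} (c s ys)
  ... | as , ds = ∧⁺ (as , ◇-mono (EU-mono a λ t p →
    let bt , yt = ∧⁻ {b t} p in ∧⁺ (bt , EG-greatest a b y c t yt)) s ds)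

  complexAlgebra : ℒ-Structure ℓ ℓ
  complexAlgebra = record
    { Carrier = 𝒫 Node
    ; _≈_     = _≗_
    ; ⊥ˢ      = ∅
    ; _∨ˢ_    = _∪_
    ; ¬ˢ_     = ∁
    ; Iˢ      = I
    ; ◇ˢ_     = ◇
    ; EUˢ     = EU
    ; EGˢ     = EG
    }

open ComplexAlgebra public using (complexAlgebra)

valuation : ∀ {ℓ k} (𝒯 : Tree ℓ) → Colouring 𝒯 k → Fin k → 𝒫 (Tree.Node 𝒯)
valuation 𝒯 σ p s = lookup (σ s) p

------------------------------------------------------------------------
-- Automata

-- k propositional variables, and state set Q = Fin m.
record Automaton (k m : ℕ) : Set where
  field
    q₀ : Fin m
    δ  : Fin m → Subset k → 𝒫 (Subset m)
    Ω  : Fin m → ℕ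

module _ {ℓ} {k m} (𝒜 : Automaton k m) (𝒯 : Tree ℓ) (σ : Colouring 𝒯 k) where
  open Automaton 𝒜
  open Tree 𝒯

  IsImageOfSuccessors : (Node → Fin m) → Node → Subset m → Set ℓ
  IsImageOfSuccessors r v D = ∀ q → q ∈ D ⇔ (∃[ v′ ] v ⟶ v′ × r v′ ≡ q)

  InfinitelyOften : (ℕ → Fin m) → Fin m → Set
  InfinitelyOften ρ q = ∀ n → ∃[ t ] n ≤ t × ρ t ≡ q

  IsMinPriority : (ℕ → Fin m) → ℕ → Set
  IsMinPriority ρ n =
    (∃[ q ] InfinitelyOften ρ q × Ω q ≡ n) ×
    (∀ q → InfinitelyOften ρ q → n ≤ Ω q)

  record IsAcceptingRun (r : Node → Fin m) : Set ℓ where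
    field
      initial    : r root ≡ q₀
      transition : ∀ v → ∃[ D ] IsImageOfSuccessors r v D × T (δ (r v) (σ v) D)
      parity     : ∀ (v : ℕ → Node) → v 0 ≡ root → (∀ t → v t ⟶ v (suc t)) →
                   ∃[ n ] IsMinPriority (λ t → r (v t)) n × 2 ∣ n

  Accepts : Set ℓ
  Accepts = ∃[ r ] IsAcceptingRun r

{-# OPTIONS --safe #-}
module Submission where

-- The equivalence holds on every tree, and is proved there before it is
-- specialised to the ω-expansion. A map r : S → Q is the same thing as a
-- valuation of the states q̄ that makes exactly one state true at each node
-- (W codes r when W q holds at s exactly if r s = q), and acc_𝒜 is a conjunction
-- of terms saying that W codes some r and that this r is an accepting run.
--
-- The local conditions are Boolean. At a node in state q, initiality says that
-- I implies q = q₀; the transition condition says that for some P and some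
-- D ∈ δ(q, P), the colour is P and, for each state q′, ◇ q′ holds exactly if
-- q′ ∈ D (transition⇔).
--
-- The parity condition is expressed by EG: for each state q of odd priority,
-- acc_𝒜 forbids EG(⋁ {q′ ∣ Ω q ≤ Ω q′}, q). EG(a, b) holds at s exactly when some
-- infinite path from s stays in a and meets b infinitely often (EG⇔path). From a
-- post-fixed point such a path is assembled by following the finite EU-paths to
-- b one after the other; the choices this requires are available because
-- excluded middle returns witnesses. Conversely the set of nodes of such a path
-- is post-fixed.
--
-- It remains to compare the two ways of saying "minimal priority"
-- (parity⇔noOddCycle). If a path from some node witnesses a forbidden EG, then
-- prepending the path from the root changes no limit behaviour, so the minimal
-- priority seen infinitely often is Ω q, which is odd. If a path from the root
-- has odd minimal priority Ω q, then from some time N on only recurrent states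
-- occur (eventuallyRecurrent), so the tail from N witnesses a forbidden EG.

open import Defs
open import Axiom.ExcludedMiddle using (ExcludedMiddle)
open import Data.Bool using (Bool; true; false; T; not; if_then_else_)
open import Data.Bool.Properties using (T-≡; T-∧; T-∨; ⇔→≡)
open import Data.Fin using (Fin; zero; suc)
open import Data.Fin.Properties using (any?) renaming (_≟_ to _≟ᶠ_)
open import Data.Fin.Subset using (Subset; _∈_; ⁅_⁆)
open import Data.Fin.Subset.Properties using (x∈⁅x⁆; x∈⁅y⁆⇒x≡y)
open import Data.List using ([]; _∷_)
open import Data.List.Relation.Unary.Linked using (Linked; _∷_)
open import Data.Nat
  using (ℕ; zero; suc; _+_; _⊔_; _≤_; _<_; _≤?_; _≤‴_; ≤‴-refl; ≤‴-step)
open import Data.Nat.Divisibility using (_∣_; _∣?_)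
open import Data.Nat.Induction using (<-rec)
open import Data.Nat.Properties
  using (≤-refl; ≤-trans; ≤-antisym; m≤m⊔n; m≤n⊔m; n≤1+n; ≮⇒≥; m≤m+n; m≤n+m;
         +-suc; m≤n⇒∃[o]m+o≡n; +-cancelˡ-≤; ≤⇒≤‴)
open import Data.Product using (Σ-syntax; ∃-syntax; _×_; _,_; proj₁; proj₂)
open import Data.Sum using (_⊎_; inj₁; inj₂; [_,_])
open import Data.Unit using (tt)
open import Data.Vec using ([]; _∷_; lookup)
open import Data.Vec.Properties using (lookup⇒[]=; []=⇒lookup; tabulate∘lookup; tabulate-cong)
open import Function using (_∘_)
open import Function.Bundles using (_⇔_; mk⇔; module Equivalence)
open import Function.Construct.Composition using (_⇔-∘_)
open import Function.Construct.Symmetry using (⇔-sym)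
open import Level using (Level; Lift; lift; lower)
open import Relation.Binary.PropositionalEquality
  using (_≡_; _≢_; refl; sym; trans; cong; subst)
open import Relation.Nullary.Decidable using (Dec; yes; no; ⌊_⌋; map′; toWitness; fromWitness)
open import Relation.Nullary.Negation using (¬_; contradiction)

open Equivalence using (to; from)

-- Booleans and finite subsets

T-not : ∀ {x} → T (not x) ⇔ (¬ T x)
T-not {true}  = mk⇔ (λ ()) (λ ¬t → ¬t tt)
T-not {false} = mk⇔ (λ _ ()) (λ _ → tt)

T-⇔→≡ : ∀ {x y} → T x ⇔ T y → x ≡ y
T-⇔→≡ e = ⇔→≡ (T-≡ ⇔-∘ (e ⇔-∘ ⇔-sym T-≡))

lookup-injective : ∀ {n} {D E : Subset n} → (∀ i → lookup D i ≡ lookup E i) → D ≡ E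
lookup-injective {D = D} {E} eq =
  trans (sym (tabulate∘lookup D)) (trans (tabulate-cong eq) (tabulate∘lookup E))

T-lookup : ∀ {n} {D : Subset n} {i} → T (lookup D i) ⇔ i ∈ D
T-lookup {D = D} {i} = mk⇔ (lookup⇒[]= i D) []=⇒lookup ⇔-∘ T-≡

T-lookup-⁅⁆ : ∀ {n} {i j : Fin n} → T (lookup ⁅ j ⁆ i) ⇔ j ≡ i
T-lookup-⁅⁆ {i = i} {j} =
  mk⇔ (sym ∘ x∈⁅y⁆⇒x≡y j) (λ { refl → x∈⁅x⁆ j }) ⇔-∘ T-lookup

-- Recurrence in sequences over a finite set

-- The value q occurs infinitely often in ρ.
Recurs : ∀ {m} → (ℕ → Fin m) → Fin m → Set
Recurs ρ q = ∀ n → ∃[ t ] n ≤ t × ρ t ≡ q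

bounded : ∀ {m} (f : Fin m → ℕ) → ∃[ N ] (∀ i → f i ≤ N)
bounded {zero}  f = 0 , λ ()
bounded {suc m} f with bounded (f ∘ suc)
... | N , f≤N = f zero ⊔ N , λ where
  zero    → m≤m⊔n (f zero) N
  (suc i) → ≤-trans (f≤N i) (m≤n⊔m (f zero) N)

module Recurrence (dec : (P : Set) → Dec P) {m : ℕ} (ρ : ℕ → Fin m) where

  -- A time N from which q occurs only if it is recurrent.
  lastOccurrence : ∀ q → ∃[ N ] (∀ t → N ≤ t → ρ t ≡ q → Recurs ρ q)
  lastOccurrence q with dec (Recurs ρ q)
  ... | yes rec = 0 , λ _ _ _ → rec
  ... | no ¬rec with dec (∃[ N ] (∀ t → N ≤ t → ρ t ≢ q))
  ...   | yes (N , never) = N , λ t N≤t eq → contradiction eq (never t N≤t)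
  ...   | no ¬bound = contradiction recurs ¬rec
    where
    recurs : Recurs ρ q
    recurs n with dec (∃[ t ] n ≤ t × ρ t ≡ q)
    ... | yes found = found
    ... | no ¬found = contradiction (n , λ t n≤t eq → ¬found (t , n≤t , eq)) ¬bound

  eventuallyRecurrent : ∃[ N ] (∀ t → N ≤ t → Recurs ρ (ρ t))
  eventuallyRecurrent with bounded (proj₁ ∘ lastOccurrence)
  ... | N , below = N , λ t N≤t →
    proj₂ (lastOccurrence (ρ t)) t (≤-trans (below (ρ t)) N≤t) refl

  minimalRecurrent : (Ω : Fin m → ℕ) →
    ∃[ q ] Recurs ρ q × (∀ q′ → Recurs ρ q′ → Ω q ≤ Ω q′)
  minimalRecurrent Ω with eventuallyRecurrent
  ... | N , rec = <-rec Claim descend _ (ρ N) refl (rec N ≤-refl)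
    where
    Claim : ℕ → Set
    Claim n = ∀ q → Ω q ≡ n → Recurs ρ q →
      ∃[ q ] Recurs ρ q × (∀ q′ → Recurs ρ q′ → Ω q ≤ Ω q′)

    descend : ∀ n → (∀ {n′} → n′ < n → Claim n′) → Claim n
    descend n ih q refl recq with any? (λ q′ → dec (Recurs ρ q′ × Ω q′ < Ω q))
    ... | yes (q′ , recq′ , less) = ih less q′ refl recq′
    ... | no none = q , recq , λ q′ recq′ → ≮⇒≥ λ less → none (q′ , recq′ , less)

-- Derived connectives of ℒ

module _ {X : Set} where

  infixr 6 _∧ᵗ_

  _∧ᵗ_ : Term X → Term X → Term X
  t ∧ᵗ u = ¬ᵗ ((¬ᵗ t) ∨ᵗ (¬ᵗ u))

  constᵗ : Bool → Term X
  constᵗ b = if b then ⊤ᵗ else ⊥ᵗ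

  ⋁ ⋀ : ∀ {n} → (Fin n → Term X) → Term X
  ⋁ {zero}  f = ⊥ᵗ
  ⋁ {suc n} f = f zero ∨ᵗ ⋁ (f ∘ suc)
  ⋀ {zero}  f = ⊤ᵗ
  ⋀ {suc n} f = f zero ∧ᵗ ⋀ (f ∘ suc)

  -- Disjunction over all subsets of an n-element set.
  ⋁ˢ : ∀ {n} → (Subset n → Term X) → Term X
  ⋁ˢ {zero}  f = f []
  ⋁ˢ {suc n} f = ⋁ˢ (f ∘ (true ∷_)) ∨ᵗ ⋁ˢ (f ∘ (false ∷_))

  -- The term saying that t has truth value b.
  literal : Bool → Term X → Term X
  literal b t = if b then t else ¬ᵗ t

  -- The term saying that, among the terms f i, exactly those with i ∈ D hold.
  profile : ∀ {n} → Subset n → (Fin n → Term X) → Term X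
  profile D f = ⋀ (λ i → literal (lookup D i) (f i))

-- The acceptance term of an automaton

module AcceptanceTerm {k m : ℕ} (𝒜 : Automaton k m) where
  open Automaton 𝒜

  colour : Fin k → Term (Fin k ⊎ Fin m)
  colour p = var (inj₁ p)

  state : Fin m → Term (Fin k ⊎ Fin m)
  state q = var (inj₂ q)

  -- The current state is q and no other.
  isState : Fin m → Term (Fin k ⊎ Fin m)
  isState q = profile ⁅ q ⁆ state

  -- The conditions on a run at a node in state q: initialᵗ q allows only the
  -- state q₀ at the root, and transitionᵗ q guesses the colour P of the node and
  -- the set D of states at its successors.
  initialᵗ : Fin m → Term (Fin k ⊎ Fin m)
  initialᵗ q = constᵗ ⌊ q ≟ᶠ q₀ ⌋ ∨ᵗ (¬ᵗ Iᵗ)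

  transitionᵗ : Fin m → Term (Fin k ⊎ Fin m)
  transitionᵗ q = ⋁ˢ λ P → ⋁ˢ λ D →
    constᵗ (δ q P D) ∧ᵗ profile P colour ∧ᵗ profile D (λ q′ → ◇ᵗ state q′)

  priority≥ : ℕ → Term (Fin k ⊎ Fin m)
  priority≥ n = ⋁ λ q → constᵗ ⌊ n ≤? Ω q ⌋ ∧ᵗ state q

  -- The disjunct constᵗ ⌊ 2 ∣? Ω q ⌋ makes the condition vacuous for even priorities.
  -- At all nodes together, the conjuncts for the states of odd priority say that
  -- no such priority is the least one occurring infinitely often on a path.
  parityᵗ : Term (Fin k ⊎ Fin m)
  parityᵗ = ⋀ λ q → constᵗ ⌊ 2 ∣? Ω q ⌋ ∨ᵗ (¬ᵗ EGᵗ (priority≥ (Ω q)) (state q))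

  localᵗ : Fin m → Term (Fin k ⊎ Fin m)
  localᵗ q = isState q ∧ᵗ initialᵗ q ∧ᵗ transitionᵗ q

  acc : Term (Fin k ⊎ Fin m)
  acc = ⋁ localᵗ ∧ᵗ parityᵗ

module OnTree {ℓ : Level} (em : ExcludedMiddle ℓ) (𝒯 : Tree ℓ) where
  open Tree 𝒯
  open ComplexAlgebra em 𝒯 hiding (complexAlgebra)
  open ℒ-Structure (complexAlgebra em 𝒯) using (⟦_⟧)

  dec : (P : Set) → Dec P
  dec P = map′ lower lift (em {Lift ℓ P})

  -- Infinite paths

  IsInfinitePath : (ℕ → Node) → Set ℓ
  IsInfinitePath v = ∀ t → v t ⟶ v (suc t)

  shift-path : ∀ N {v} → IsInfinitePath v → IsInfinitePath (λ t → v (N + t))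
  shift-path N {v} path t = subst (v (N + t) ⟶_) (cong v (sym (+-suc N t))) (path (N + t))

  _◂_ : Node → (ℕ → Node) → ℕ → Node
  (s ◂ v) zero    = s
  (s ◂ v) (suc t) = v t

  ◂-path : ∀ {s v} → s ⟶ v 0 → IsInfinitePath v → IsInfinitePath (s ◂ v)
  ◂-path r path zero    = r
  ◂-path r path (suc t) = path t

  -- A finite path from s to v 0, followed by v.
  prepend : ∀ s w v → Linked _⟶_ (s ∷ w) → endpoint s w ≡ v 0 → IsInfinitePath v →
    ∃[ u ] u 0 ≡ s × IsInfinitePath u × ∃[ N ] (∀ t → u (N + t) ≡ v t)
  prepend s []      v _       end path = v , sym end , path , 0 , λ _ → refl
  prepend s (x ∷ w) v (r ∷ l) end path with prepend x w v l end path
  ... | u , u₀≡x , pathᵘ , N , tail =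
    s ◂ u , refl , ◂-path (subst (s ⟶_) (sym u₀≡x) r) pathᵘ , suc N , tail

  fromRoot : ∀ v → IsInfinitePath v →
    ∃[ u ] u 0 ≡ root × IsInfinitePath u × ∃[ N ] (∀ t → u (N + t) ≡ v t)
  fromRoot v path with reachable (v 0)
  ... | w , l , end = prepend root w v l end path

  -- Path semantics of EU and EG

  -- Until b a s: the finite paths from s that stay in a until they end in b.
  data Until (b a : 𝒫 Node) : Node → Set ℓ where
    here  : ∀ {s} → T (b s) → Until b a s
    there : ∀ {s t} → T (a s) → s ⟶ t → Until b a t → Until b a s

  EU⇔Until : ∀ {b a s} → T (EU b a s) ⇔ Until b a s
  EU⇔Until {b} {a} = mk⇔ (λ h → toWitness (EU-least b a _ closed _ h)) complete
    where
    closed : EU-closed b a ⟨ Until b a ⟩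
    closed s h with to (T-∨ {b s}) h
    ... | inj₁ bs = fromWitness (here bs)
    ... | inj₂ h′ with to (T-∧ {a s}) h′
    ... | as , h″ with toWitness h″
    ... | t , ut , st = fromWitness (there as st (toWitness ut))

    complete : ∀ {s} → Until b a s → T (EU b a s)
    complete (here bs) = EU-isClosed b a _ (from T-∨ (inj₁ bs))
    complete {s} (there as st u) = EU-isClosed b a _
      (from (T-∨ {b s}) (inj₂ (from T-∧ (as , fromWitness (_ , complete u , st)))))

  -- The infinite paths that stay in a and meet b infinitely often.
  record IsEGPath (a b : 𝒫 Node) (v : ℕ → Node) : Set ℓ where
    field
      path   : IsInfinitePath v
      always : ∀ t → T (a (v t))
      often  : ∀ n → ∃[ t ] n ≤ t × T (b (v t))

  -- An infinite path that returns to the post-fixed point y infinitely often. A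
  -- state of its construction carries the finite path still to be followed to the
  -- next node of b ∩ y; on arrival there, post-fixedness supplies a successor with
  -- a new such path.
  module Unfold {a b y : 𝒫 Node} (closed : EG-closed a b y) where

    State : Set ℓ
    State = Σ[ s ∈ Node ] Until (b ∩ y) a s

    renew : ∀ s → T (y s) → T (a s) × ∃[ t ] (s ⟶ t × Until (b ∩ y) a t)
    renew s ys with to (T-∧ {a s}) (closed s ys)
    ... | as , h with toWitness h
    ... | t , eu , st = as , t , st , to EU⇔Until eu

    advance : ∀ {s} → Until (b ∩ y) a s → T (a s) × ∃[ t ] (s ⟶ t × Until (b ∩ y) a t)
    advance {s} (here bys)      = renew s (proj₂ (to (T-∧ {b s}) bys))
    advance     (there as st u) = as , _ , st , u

    next : State → State
    next (_ , u) with advance u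
    ... | _ , t , _ , u′ = t , u′

    run : State → ℕ → State
    run x zero    = x
    run x (suc n) = next (run x n)

    reaches-b : ∀ x n {s} (u : Until (b ∩ y) a s) → run x n ≡ (s , u) →
      ∃[ t ] n ≤ t × T (b (proj₁ (run x t)))
    reaches-b x n {s} (here bys) eq =
      n , ≤-refl , subst (T ∘ b ∘ proj₁) (sym eq) (proj₁ (to (T-∧ {b s}) bys))
    reaches-b x n (there as st u) eq with reaches-b x (suc n) u (cong next eq)
    ... | t , n<t , bt = t , ≤-trans (n≤1+n n) n<t , bt

    run-isEGPath : ∀ x → IsEGPath a b (proj₁ ∘ run x)
    run-isEGPath x = record
      { path   = λ t → proj₁ (proj₂ (proj₂ (advance (proj₂ (run x t)))))
      ; always = λ t → proj₁ (advance (proj₂ (run x t)))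
      ; often  = λ n → reaches-b x n (proj₂ (run x n)) refl
      }

  EG⇔path : ∀ {a b s} → T (EG a b s) ⇔ (∃[ v ] v 0 ≡ s × IsEGPath a b v)
  EG⇔path {a} {b} = mk⇔ unfold (λ { (v , refl , p) → fold v p })
    where
    unfold : ∀ {s} → T (EG a b s) → ∃[ v ] v 0 ≡ s × IsEGPath a b v
    unfold {s} h with toWitness h
    ... | y , closed , ys = v , refl , Unfold.run-isEGPath closed x
      where
      -- The node s itself is in y but need not be in b, so that the first
      -- finite path has to start with the step that leaves s.
      x : Unfold.State closed
      x with Unfold.renew closed s ys
      ... | as , _ , st , u = s , there as st u

      v : ℕ → Node
      v = proj₁ ∘ Unfold.run closed x

    fold : ∀ v → IsEGPath a b v → T (EG a b (v 0))
    fold v p = EG-greatest a b y closed (v 0) (fromWitness (0 , refl))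
      where
      open IsEGPath p

      y : 𝒫 Node
      y = ⟨ (λ s → ∃[ t ] s ≡ v t) ⟩

      climb : ∀ {n t} → n ≤‴ t → T (b (v t)) → Until (b ∩ y) a (v n)
      climb {n} ≤‴-refl       bt = here (from T-∧ (bt , fromWitness (n , refl)))
      climb {n} (≤‴-step n<t) bt = there (always n) (path n) (climb n<t bt)

      closed : EG-closed a b y
      closed s ys with toWitness ys
      ... | t , refl with often (suc t)
      ... | t′ , t<t′ , bt′ = from T-∧
        ( always t
        , fromWitness (v (suc t) , from EU⇔Until (climb (≤⇒≤‴ t<t′) bt′) , path t))

  -- Semantics of the derived connectives

  module Satisfaction {X : Set} (V : X → 𝒫 Node) where

    infix 4 _⊨_

    _⊨_ : Node → Term X → Set
    s ⊨ t = T (⟦ t ⟧ V s)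

    ⊨-∨ : ∀ {s} t u → s ⊨ t ∨ᵗ u ⇔ (s ⊨ t ⊎ s ⊨ u)
    ⊨-∨ t u = T-∨

    ⊨-¬ : ∀ {s} t → s ⊨ ¬ᵗ t ⇔ (¬ s ⊨ t)
    ⊨-¬ t = T-not

    ⊨-∧ : ∀ {s} t u → s ⊨ t ∧ᵗ u ⇔ (s ⊨ t × s ⊨ u)
    ⊨-∧ {s} t u with ⟦ t ⟧ V s | ⟦ u ⟧ V s
    ... | true  | true  = mk⇔ (λ _ → tt , tt) (λ _ → tt)
    ... | true  | false = mk⇔ (λ ()) proj₂
    ... | false | _     = mk⇔ (λ ()) proj₁

    ⊨-const : ∀ {s} b → s ⊨ constᵗ b ⇔ T b
    ⊨-const true  = mk⇔ (λ p → p) (λ p → p)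
    ⊨-const false = mk⇔ (λ p → p) (λ p → p)

    ⊨-dec : ∀ {s} {p} {P : Set p} (P? : Dec P) → s ⊨ constᵗ ⌊ P? ⌋ ⇔ P
    ⊨-dec P? = mk⇔ toWitness fromWitness ⇔-∘ ⊨-const ⌊ P? ⌋

    ⊨-⋁ : ∀ {s n} (f : Fin n → Term X) → s ⊨ ⋁ f ⇔ (∃[ i ] s ⊨ f i)
    ⊨-⋁ {s} {zero}  f = mk⇔ (λ ()) (λ { (() , _) })
    ⊨-⋁ {s} {suc n} f = mk⇔ split join ⇔-∘ ⊨-∨ (f zero) (⋁ (f ∘ suc))
      where
      split : s ⊨ f zero ⊎ s ⊨ ⋁ (f ∘ suc) → ∃[ i ] s ⊨ f i
      split (inj₁ h) = zero , h
      split (inj₂ h) with to (⊨-⋁ (f ∘ suc)) h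
      ... | i , hi = suc i , hi

      join : ∃[ i ] s ⊨ f i → s ⊨ f zero ⊎ s ⊨ ⋁ (f ∘ suc)
      join (zero  , h) = inj₁ h
      join (suc i , h) = inj₂ (from (⊨-⋁ (f ∘ suc)) (i , h))

    ⊨-⋀ : ∀ {s n} (f : Fin n → Term X) → s ⊨ ⋀ f ⇔ (∀ i → s ⊨ f i)
    ⊨-⋀ {s} {zero}  f = mk⇔ (λ _ ()) (λ _ → tt)
    ⊨-⋀ {s} {suc n} f = mk⇔
      (λ { (h₀ , h) zero → h₀ ; (h₀ , h) (suc i) → to (⊨-⋀ (f ∘ suc)) h i })
      (λ h → h zero , from (⊨-⋀ (f ∘ suc)) (h ∘ suc))
      ⇔-∘ ⊨-∧ (f zero) (⋀ (f ∘ suc))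

    ⊨-⋁ˢ : ∀ {s n} (f : Subset n → Term X) → s ⊨ ⋁ˢ f ⇔ (∃[ D ] s ⊨ f D)
    ⊨-⋁ˢ {s} {zero}  f = mk⇔ (λ h → [] , h) (λ { ([] , h) → h })
    ⊨-⋁ˢ {s} {suc n} f =
      mk⇔ split join ⇔-∘ ⊨-∨ (⋁ˢ (f ∘ (true ∷_))) (⋁ˢ (f ∘ (false ∷_)))
      where
      split : s ⊨ ⋁ˢ (f ∘ (true ∷_)) ⊎ s ⊨ ⋁ˢ (f ∘ (false ∷_)) → ∃[ D ] s ⊨ f D
      split (inj₁ h) with to (⊨-⋁ˢ (f ∘ (true ∷_))) h
      ... | D , hD = true ∷ D , hD
      split (inj₂ h) with to (⊨-⋁ˢ (f ∘ (false ∷_))) h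
      ... | D , hD = false ∷ D , hD

      join : ∃[ D ] s ⊨ f D → s ⊨ ⋁ˢ (f ∘ (true ∷_)) ⊎ s ⊨ ⋁ˢ (f ∘ (false ∷_))
      join (true  ∷ D , h) = inj₁ (from (⊨-⋁ˢ (f ∘ (true ∷_))) (D , h))
      join (false ∷ D , h) = inj₂ (from (⊨-⋁ˢ (f ∘ (false ∷_))) (D , h))

    ⊨-literal : ∀ {s} b t → s ⊨ literal b t ⇔ ⟦ t ⟧ V s ≡ b
    ⊨-literal true  t = T-≡
    ⊨-literal {s} false t with ⟦ t ⟧ V s
    ... | true  = mk⇔ (λ ()) (λ ())
    ... | false = mk⇔ (λ _ → refl) (λ _ → tt)

    ⊨-profile : ∀ {s n} (D : Subset n) (f : Fin n → Term X) →
      s ⊨ profile D f ⇔ (∀ i → ⟦ f i ⟧ V s ≡ lookup D i)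
    ⊨-profile D f = mk⇔
      (λ h i → to (⊨-literal (lookup D i) (f i)) (h i))
      (λ h i → from (⊨-literal (lookup D i) (f i)) (h i))
      ⇔-∘ ⊨-⋀ (λ i → literal (lookup D i) (f i))

  -- Runs and their codes

  module Runs {k m : ℕ} (𝒜 : Automaton k m) (σ : Colouring 𝒯 k) where
    open Automaton 𝒜
    open AcceptanceTerm 𝒜

    -- W codes r when, at each node s, the only state in W at s is r s.
    Codes : (Fin m → 𝒫 Node) → (Node → Fin m) → Set ℓ
    Codes W r = ∀ s q → W q s ≡ lookup ⁅ r s ⁆ q

    module Coded (W : Fin m → 𝒫 Node) (r : Node → Fin m) (codes : Codes W r) where
      open Satisfaction [ valuation 𝒯 σ , W ]

      state⇔ : ∀ {s q} → s ⊨ state q ⇔ r s ≡ q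
      state⇔ {s} {q} = subst (λ b → T b ⇔ r s ≡ q) (sym (codes s q)) T-lookup-⁅⁆

      isState⇔ : ∀ {s q} → s ⊨ isState q ⇔ r s ≡ q
      isState⇔ {s} {q} = mk⇔
        (λ h → to state⇔ (subst T (sym (h q)) (from (T-lookup-⁅⁆ {i = q}) refl)))
        (λ { refl → codes s })
        ⇔-∘ ⊨-profile {s} ⁅ q ⁆ state

      priority⇔ : ∀ {s n} → s ⊨ priority≥ n ⇔ n ≤ Ω (r s)
      priority⇔ {s} {n} = mk⇔ sound complete ⇔-∘ ⊨-⋁ {s} disjunct
        where
        disjunct : Fin m → Term (Fin k ⊎ Fin m)
        disjunct q = constᵗ ⌊ n ≤? Ω q ⌋ ∧ᵗ state q

        sound : ∃[ q ] s ⊨ disjunct q → n ≤ Ω (r s)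
        sound (q , h) with to (⊨-∧ (constᵗ ⌊ n ≤? Ω q ⌋) (state q)) h
        ... | hn , hq with to state⇔ hq
        ... | refl = to (⊨-dec (n ≤? Ω q)) hn

        complete : n ≤ Ω (r s) → ∃[ q ] s ⊨ disjunct q
        complete n≤ = r s , from (⊨-∧ (constᵗ ⌊ n ≤? Ω (r s) ⌋) (state (r s)))
          (from (⊨-dec (n ≤? Ω (r s))) n≤ , from state⇔ refl)

      initial⇔ : (∀ s → s ⊨ initialᵗ (r s)) ⇔ r root ≡ q₀
      initial⇔ = mk⇔ sound complete
        where
        sound : (∀ s → s ⊨ initialᵗ (r s)) → r root ≡ q₀
        sound h with to (⊨-∨ (constᵗ ⌊ r root ≟ᶠ q₀ ⌋) (¬ᵗ Iᵗ)) (h root)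
        ... | inj₁ h₀ = to (⊨-dec (r root ≟ᶠ q₀)) h₀
        ... | inj₂ ¬I = contradiction (fromWitness refl) (to (⊨-¬ Iᵗ) ¬I)

        complete : r root ≡ q₀ → ∀ s → s ⊨ initialᵗ (r s)
        complete eq s = by em
          where
          by : Dec (s ≡ root) → s ⊨ initialᵗ (r s)
          by (yes refl) = from (⊨-∨ (constᵗ ⌊ r s ≟ᶠ q₀ ⌋) (¬ᵗ Iᵗ))
            (inj₁ (from (⊨-dec (r s ≟ᶠ q₀)) eq))
          by (no s≢root) = from (⊨-∨ (constᵗ ⌊ r s ≟ᶠ q₀ ⌋) (¬ᵗ Iᵗ))
            (inj₂ (from (⊨-¬ {s} Iᵗ) (s≢root ∘ toWitness)))

      ◇state⇔ : ∀ {s q} → s ⊨ ◇ᵗ state q ⇔ (∃[ t ] s ⟶ t × r t ≡ q)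
      ◇state⇔ {s} {q} = mk⇔ sound (λ { (t , st , eq) → fromWitness (t , from state⇔ eq , st) })
        where
        sound : s ⊨ ◇ᵗ state q → ∃[ t ] s ⟶ t × r t ≡ q
        sound h with toWitness h
        ... | t , ht , st = t , st , to state⇔ ht

      image⇔ : ∀ {s D} →
        s ⊨ profile D (λ q → ◇ᵗ state q) ⇔ IsImageOfSuccessors 𝒜 𝒯 σ r s D
      image⇔ {s} {D} = mk⇔
        (λ h q → ◇state⇔ ⇔-∘ subst (λ b → q ∈ D ⇔ T b) (sym (h q)) (⇔-sym T-lookup))
        (λ im q → T-⇔→≡ (⇔-sym T-lookup ⇔-∘ (⇔-sym (im q) ⇔-∘ ◇state⇔)))
        ⇔-∘ ⊨-profile {s} D (λ q → ◇ᵗ state q)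

      colour⇔ : ∀ {s P} → s ⊨ profile P colour ⇔ σ s ≡ P
      colour⇔ {s} {P} = mk⇔ lookup-injective (λ { refl _ → refl }) ⇔-∘ ⊨-profile {s} P colour

      transition⇔ : ∀ {s} → s ⊨ transitionᵗ (r s) ⇔
        (∃[ D ] IsImageOfSuccessors 𝒜 𝒯 σ r s D × T (δ (r s) (σ s) D))
      transition⇔ {s} = mk⇔ sound complete
        where
        isDelta isColour isImage : Subset k → Subset m → Term (Fin k ⊎ Fin m)
        isDelta  P D = constᵗ (δ (r s) P D)
        isColour P D = profile P colour
        isImage  P D = profile D (λ q → ◇ᵗ state q)

        disjunct : Subset k → Subset m → Term (Fin k ⊎ Fin m)
        disjunct P D = isDelta P D ∧ᵗ isColour P D ∧ᵗ isImage P D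

        sound : s ⊨ transitionᵗ (r s) →
          ∃[ D ] IsImageOfSuccessors 𝒜 𝒯 σ r s D × T (δ (r s) (σ s) D)
        sound h with to (⊨-⋁ˢ (λ P → ⋁ˢ (disjunct P))) h
        ... | P , hP with to (⊨-⋁ˢ (disjunct P)) hP
        ... | D , hD with to (⊨-∧ (isDelta P D) (isColour P D ∧ᵗ isImage P D)) hD
        ... | hδ , hD′ with to (⊨-∧ (isColour P D) (isImage P D)) hD′
        ... | hσ , him with to (colour⇔ {P = P}) hσ
        ... | refl = D , to (image⇔ {D = D}) him , to (⊨-const (δ (r s) P D)) hδ

        complete : ∃[ D ] IsImageOfSuccessors 𝒜 𝒯 σ r s D × T (δ (r s) (σ s) D) →
          s ⊨ transitionᵗ (r s)
        complete (D , im , d) =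
          from (⊨-⋁ˢ (λ P → ⋁ˢ (disjunct P))) (P , from (⊨-⋁ˢ (disjunct P)) (D ,
            from (⊨-∧ (isDelta P D) (isColour P D ∧ᵗ isImage P D))
              ( from (⊨-const _) d
              , from (⊨-∧ (isColour P D) (isImage P D))
                  (from (colour⇔ {P = P}) refl , from (image⇔ {D = D}) im))))
          where
          P : Subset k
          P = σ s

      -- The paths that the conjunct of parityᵗ for q forbids if Ω q is odd.
      IsCycle : Fin m → (ℕ → Node) → Set ℓ
      IsCycle q = IsEGPath (⟦ priority≥ (Ω q) ⟧ [ valuation 𝒯 σ , W ]) (W q)

      NoOddCycle : Set ℓ
      NoOddCycle = ∀ q v → IsCycle q v → 2 ∣ Ω q

      parityᵗ⇔ : (∀ s → s ⊨ parityᵗ) ⇔ NoOddCycle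
      parityᵗ⇔ = mk⇔ sound complete
        where
        even cycleFree : Fin m → Term (Fin k ⊎ Fin m)
        even      q = constᵗ ⌊ 2 ∣? Ω q ⌋
        cycleFree q = ¬ᵗ EGᵗ (priority≥ (Ω q)) (state q)

        sound : (∀ s → s ⊨ parityᵗ) → NoOddCycle
        sound h q v c with to (⊨-∨ (even q) (cycleFree q))
                              (to (⊨-⋀ (λ q → even q ∨ᵗ cycleFree q)) (h (v 0)) q)
        ... | inj₁ e = to (⊨-dec (2 ∣? Ω q)) e
        ... | inj₂ ¬eg = contradiction (from EG⇔path (v , refl , c))
                           (to (⊨-¬ (EGᵗ (priority≥ (Ω q)) (state q))) ¬eg)

        complete : NoOddCycle → ∀ s → s ⊨ parityᵗ
        complete noc s = from (⊨-⋀ (λ q → even q ∨ᵗ cycleFree q)) at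
          where
          at : ∀ q → s ⊨ even q ∨ᵗ cycleFree q
          at q = from (⊨-∨ (even q) (cycleFree q)) (by (2 ∣? Ω q))
            where
            by : Dec (2 ∣ Ω q) → s ⊨ even q ⊎ s ⊨ cycleFree q
            by (yes e) = inj₁ (from (⊨-dec (2 ∣? Ω q)) e)
            by (no ¬e) = inj₂ (from (⊨-¬ {s} (EGᵗ (priority≥ (Ω q)) (state q))) λ eg →
              let v , _ , c = to EG⇔path eg in ¬e (noc q v c))

      ParityCondition : Set ℓ
      ParityCondition = ∀ v → v 0 ≡ root → IsInfinitePath v →
        ∃[ n ] IsMinPriority 𝒜 𝒯 σ (λ t → r (v t)) n × 2 ∣ n

      parity⇔noOddCycle : NoOddCycle ⇔ ParityCondition
      parity⇔noOddCycle = mk⇔ sound complete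
        where
        -- The witness path is the tail of v from a time N such that only recurrent
        -- states occur from N on, so that minimality bounds their priorities.
        sound : NoOddCycle → ParityCondition
        sound noc v _ path with Recurrence.minimalRecurrent dec (r ∘ v) Ω
                              | Recurrence.eventuallyRecurrent dec (r ∘ v)
        ... | q , rec , least | N , recurrent =
          Ω q , ((q , rec , refl) , least) , noc q (λ t → v (N + t)) record
            { path   = shift-path N path
            ; always = λ t → from priority⇔ (least _ (recurrent (N + t) (m≤m+n N t)))
            ; often  = often
            }
          where
          often : ∀ n → ∃[ t ] n ≤ t × T (W q (v (N + t)))
          often n with rec (N + n)
          ... | t , N+n≤t , eq with m≤n⇒∃[o]m+o≡n (≤-trans (m≤m+n N n) N+n≤t)
          ... | o , refl = o , +-cancelˡ-≤ N n o N+n≤t , from state⇔ eq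

        complete : ParityCondition → NoOddCycle
        complete par q v c with fromRoot v (IsEGPath.path c)
        ... | u , u₀ , pathᵘ , N , tail with par u u₀ pathᵘ
        ... | n , ((q′ , rec′ , refl) , least) , even =
          subst (2 ∣_) (≤-antisym (least q recurs) above) even
          where
          open IsEGPath c

          -- Positions of v from n on are positions of u from N + n on.
          recurs : Recurs (r ∘ u) q
          recurs n with often n
          ... | t , n≤t , bt =
            N + t , ≤-trans n≤t (m≤n+m t N) , trans (cong r (tail t)) (to state⇔ bt)

          above : Ω q ≤ Ω q′
          above with rec′ N
          ... | t , N≤t , refl with m≤n⇒∃[o]m+o≡n N≤t
          ... | o , refl = subst (λ s → Ω q ≤ Ω (r s)) (sym (tail o)) (to priority⇔ (always o))

      acc⇔run : (∀ s → s ⊨ acc) ⇔ IsAcceptingRun 𝒜 𝒯 σ r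
      acc⇔run = mk⇔ sound complete
        where
        here-local : ∀ s → s ⊨ acc → s ⊨ initialᵗ (r s) × s ⊨ transitionᵗ (r s)
        here-local s h with to (⊨-⋁ localᵗ) (proj₁ (to (⊨-∧ (⋁ localᵗ) parityᵗ) h))
        ... | q , hq with to (⊨-∧ (isState q) (initialᵗ q ∧ᵗ transitionᵗ q)) hq
        ... | hs , hl with to (isState⇔ {q = q}) hs
        ... | refl = to (⊨-∧ (initialᵗ q) (transitionᵗ q)) hl

        sound : (∀ s → s ⊨ acc) → IsAcceptingRun 𝒜 𝒯 σ r
        sound h = record
          { initial    = to initial⇔ λ s → proj₁ (here-local s (h s))
          ; transition = λ s → to transition⇔ (proj₂ (here-local s (h s)))
          ; parity     = to parity⇔noOddCycle (to parityᵗ⇔ λ s →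
                           proj₂ (to (⊨-∧ (⋁ localᵗ) parityᵗ) (h s)))
          }

        complete : IsAcceptingRun 𝒜 𝒯 σ r → ∀ s → s ⊨ acc
        complete run s = from (⊨-∧ (⋁ localᵗ) parityᵗ)
          ( from (⊨-⋁ localᵗ) (r s ,
              from (⊨-∧ (isState (r s)) (initialᵗ (r s) ∧ᵗ transitionᵗ (r s)))
                ( from (isState⇔ {q = r s}) refl
                , from (⊨-∧ (initialᵗ (r s)) (transitionᵗ (r s)))
                    (from initial⇔ initial s , from transition⇔ (transition s))))
          , from parityᵗ⇔ (from parity⇔noOddCycle parity) s)
          where open IsAcceptingRun run

    -- Where acc holds, some isState q holds, and q is the value of the run.
    decode : ∀ W → (∀ s → Satisfaction._⊨_ [ valuation 𝒯 σ , W ] s acc) →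
      ∃[ r ] Codes W r
    decode W h = proj₁ ∘ find , proj₂ ∘ find
      where
      open Satisfaction [ valuation 𝒯 σ , W ]

      find : ∀ s → ∃[ q ] (∀ q′ → W q′ s ≡ lookup ⁅ q ⁆ q′)
      find s with to (⊨-⋁ localᵗ) (proj₁ (to (⊨-∧ (⋁ localᵗ) parityᵗ) (h s)))
      ... | q , hq = q , to (⊨-profile {s} ⁅ q ⁆ state)
        (proj₁ (to (⊨-∧ (isState q) (initialᵗ q ∧ᵗ transitionᵗ q)) hq))

    accepts⇔acc : Accepts 𝒜 𝒯 σ ⇔
      (Σ[ W ∈ (Fin m → 𝒫 Node) ] (∀ s → ⟦ acc ⟧ [ valuation 𝒯 σ , W ] s ≡ true))
    accepts⇔acc = mk⇔
      (λ { (r , run) → (λ q s → lookup ⁅ r s ⁆ q) , λ s →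
             to T-≡ (from (Coded.acc⇔run _ r (λ _ _ → refl)) run s) })
      (λ { (W , eq) → let h = λ s → from T-≡ (eq s) ; r , codes = decode W h in
             r , to (Coded.acc⇔run W r codes) h })

proposition4p8 : ∀ {ℓ} {k m : ℕ} (𝒜 : Automaton k m) →
    Σ[ acc ∈ Term (Fin k ⊎ Fin m) ]
      ((em : ExcludedMiddle ℓ) (𝒯 : Tree ℓ) (σ : Colouring 𝒯 k) →
       let open ℒ-Structure (complexAlgebra em (expansion 𝒯))
           V = valuation (expansion 𝒯) (expandColouring 𝒯 σ)
       in Accepts 𝒜 (expansion 𝒯) (expandColouring 𝒯 σ)
          ⇔ (Σ[ W ∈ (Fin m → Carrier) ] ⟦ acc ⟧ [ V , W ] ≈ ⟦ ⊤ᵗ ⟧ [ V , W ]))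
proposition4p8 𝒜 = AcceptanceTerm.acc 𝒜 , λ em 𝒯 σ →
  OnTree.Runs.accepts⇔acc em (expansion 𝒯) 𝒜 (expandColouring 𝒯 σ)
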